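{- Let $i\ge 3$ and $k\ge 3$ be integers, let $p$ be a nonnegative integer, and put $r=\lfloor (L_i-1)/F_k\rfloor$. If $r\ge p$ and $(r,p)\ne(0,0)$, then $$g_p(L_i,L_{i+2},L_{i+k})=\begin{cases}(L_i-rF_k-1)L_{i+2}+(r+p)L_{i+k}-L_i & \text{if } (L_i-rF_k)L_{i+2}\ge F_{k-2}L_i,\\ (F_k-1)L_{i+2}+(r+p-1)L_{i+k}-L_i & \text{if } (L_i-rF_k)L_{i+2}< F_{k-2}L_i.\end{cases}$$
   Context: Fibonacci numbers: $F_0=0$, $F_1=1$, $F_n=F_{n-1}+F_{n-2}$. Lucas numbers: $L_0=2$, $L_1=1$, $L_n=L_{n-1}+L_{n-2}$. For positive integers $a_1,\dots,a_l$ with $\gcd(a_1,\dots,a_l)=1$ and an integer $n$, let $d(n;a_1,\dots,a_l)$ be the number of tuples $(x_1,\dots,x_l)$ of nonnegative integers with $a_1x_1+\dots+a_lx_l=n$. For a nonnegative integer $p$, the $p$-Frobenius number $g_p(a_1,\dots,a_l)$ is the largest integer $n$ with $d(n;a_1,\dots,a_l)\le p$. -}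

module Defs where

open import Data.Nat.Base using (ℕ; zero; suc; _+_; _*_; _≤_; _<_; s≤s; z≤n; NonZero; >-nonZero)
open import Data.Nat.Properties
  using (_≟_; ≤-trans; m≤n*m; m≤m+n; m≤n+m; ≤-reflexive; m≤n⇒m≤n+o)
open import Data.Integer.Base as ℤ using (ℤ; +_; -[1+_])
open import Data.List.Base using (List; []; _∷_; length; filter; upTo; cartesianProductWith)
open import Data.List.Membership.Propositional using (_∈_)
open import Data.List.Membership.Propositional.Properties
  using (∈-upTo⁺; ∈-cartesianProductWith⁺; ∈-filter⁺; ∈-filter⁻)
open import Data.List.Relation.Unary.Any using (here)
open import Data.List.Relation.Unary.All as ListAll using ()
open import Data.List.Relation.Unary.AllPairs using ([]; _∷_)
open import Data.List.Relation.Unary.Unique.Propositional using (Unique)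
open import Data.List.Relation.Unary.Unique.Propositional.Properties
  using (upTo⁺; cartesianProductWith⁺; filter⁺)
open import Data.Product.Base using (_×_; _,_; proj₂)
open import Data.Vec.Base using (Vec; []; _∷_; zipWith; sum)
open import Data.Vec.Properties using (∷-injective)
open import Data.Vec.Relation.Unary.All using (All; []; _∷_)
open import Function.Bundles using (_⇔_; mk⇔)
open import Relation.Binary.PropositionalEquality using (_≡_; refl)

F : ℕ → ℕ
F zero          = 0
F (suc zero)    = 1
F (suc (suc n)) = F (suc n) + F n

L : ℕ → ℕ
L zero          = 2
L (suc zero)    = 1
L (suc (suc n)) = L (suc n) + L n

F-pos : ∀ n → 0 < F (suc n)
F-pos zero    = s≤s z≤n
F-pos (suc n) = m≤n⇒m≤n+o (F n) (F-pos n)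

F-nonZero : ∀ {k} → 3 ≤ k → NonZero (F k)
F-nonZero {suc k} _ = >-nonZero (F-pos k)

L-pos : ∀ n → 0 < L n
L-pos zero          = s≤s z≤n
L-pos (suc zero)    = s≤s z≤n
L-pos (suc (suc n)) = m≤n⇒m≤n+o (L n) (L-pos (suc n))

L-nonZero : ∀ n → NonZero (L n)
L-nonZero n = >-nonZero (L-pos n)

infix 7 _·_

_·_ : ∀ {l} → Vec ℕ l → Vec ℕ l → ℕ
a · x = sum (zipWith _*_ a x)

-- All l-tuples with entries in {0, …, b}.
tuples : ∀ l → ℕ → List (Vec ℕ l)
tuples zero    b = [] ∷ []
tuples (suc l) b = cartesianProductWith _∷_ (upTo (suc b)) (tuples l b)

-- The search is bounded by n: when every aⱼ is positive, a · x ≡ n forces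
-- xⱼ ≤ n for all j.  Completeness is ∈-solutions below; the list has no
-- repetitions by solutions-unique.
solutions : ∀ {l} → ℕ → Vec ℕ l → List (Vec ℕ l)
solutions {l} n a = filter (λ x → a · x ≟ n) (tuples l n)

d : ∀ {l} → ℤ → Vec ℕ l → ℕ
d (+ n)    a = length (solutions n a)
d -[1+ _ ] a = 0

-- g = g_p(a₁, …, a_l): the largest integer n, possibly negative, with d(n; a) ≤ p.
IsFrobenius : ∀ {l} → ℕ → Vec ℕ l → ℤ → Set
IsFrobenius p a g = d g a ≤ p × (∀ (n : ℤ) → d n a ≤ p → n ℤ.≤ g)

tuples-unique : ∀ l b → Unique (tuples l b)
tuples-unique zero    b = ListAll.[] ∷ []
tuples-unique (suc l) b =
  cartesianProductWith⁺ _∷_ ∷-injective (upTo⁺ (suc b)) (tuples-unique l b)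

solutions-unique : ∀ {l} n (a : Vec ℕ l) → Unique (solutions n a)
solutions-unique {l} n a = filter⁺ (λ x → a · x ≟ n) (tuples-unique l n)

∈-tuples : ∀ {l} b {a : Vec ℕ l} → All NonZero a → ∀ x → a · x ≤ b → x ∈ tuples l b
∈-tuples b []                   []       _   = here refl
∈-tuples b {a ∷ as} (a≢0 ∷ as≢0) (x ∷ xs) ≤b =
  ∈-cartesianProductWith⁺ _∷_
    (∈-upTo⁺ (s≤s (≤-trans (m≤n*m x a {{a≢0}}) (≤-trans (m≤m+n (a * x) (as · xs)) ≤b))))
    (∈-tuples b as≢0 xs (≤-trans (m≤n+m (as · xs) (a * x)) ≤b))

∈-solutions : ∀ {l} n {a : Vec ℕ l} → All NonZero a → ∀ x → x ∈ solutions n a ⇔ a · x ≡ n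
∈-solutions {l} n {a} a≢0 x = mk⇔
  (λ x∈ → proj₂ (∈-filter⁻ P? {xs = tuples l n} x∈))
  (λ eq → ∈-filter⁺ P? (∈-tuples n a≢0 x (≤-reflexive eq)) eq)
  where P? = λ y → a · y ≟ n

{-# OPTIONS --safe #-}

-- Write a = Lᵢ, b = Lᵢ₊₂, c = Lᵢ₊ₖ, u = Fₖ₋₂ and w = Fₖ, so that c + u a = w b.  Modulo a the value
-- b y + c z depends only on s = y + w z, since b y + c z = b s - u a z; so the solutions for n
-- correspond to the pairs (s, z) with w z ≤ s, b s ≡ n (mod a) and b s - u a z ≤ n.
--
-- The claimed value is b Y + c Z - a with Y < w.  A solution for it has s = Y + w Z - a, because the
-- cheapest pair with s ≥ Y + w Z in the right class already costs b Y + c Z; such an s is less than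
-- p w, which leaves at most p values of z.  For larger n, with b t ≡ n (mod a) and 0 ≤ t < a, the
-- largest z available for s = t, and then for s = t + a, give p + 1 solutions.
module Submission where

open import Defs
open import Data.Nat.Base as ℕ using (ℕ; zero; suc; _∸_; z≤n; s≤s; NonZero; >-nonZero)
open import Data.Nat.Properties
open import Data.Nat.Divisibility using (_∣_; divides; divides-refl; ∣m+n∣m⇒∣n; m∣m*n)
open import Data.Nat.DivMod using (_/_; _%_; m≡m%n+[m/n]*n; m%n<n; m*n/n≡m; /-monoˡ-≤)
open import Data.Nat.Coprimality as Coprimality using (Coprime; coprime-divisor; coprime-Bézout; coprime-+)
open import Data.Nat.GCD using (module Bézout)
open import Data.Nat.Tactic.RingSolver using (solve-∀)
open import Data.Empty using (⊥)
open import Data.Fin.Base using (Fin; zero; suc; fromℕ<; toℕ)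
open import Data.Fin.Properties using (injective⇒≤; fromℕ<-injective; toℕ<n; toℕ-injective)
open import Data.Integer.Base as ℤ using (ℤ)
open import Data.List.Base using (List; _∷_; length; lookup)
open import Data.List.Membership.Propositional using (_∈_)
open import Data.List.Membership.Propositional.Properties using (∈-lookup)
open import Data.List.Relation.Unary.All as ListAll using ()
open import Data.List.Relation.Unary.AllPairs using (_∷_)
open import Data.List.Relation.Unary.Any using (index)
open import Data.List.Relation.Unary.Any.Properties using (lookup-index)
open import Data.List.Relation.Unary.Unique.Propositional using (Unique)
open import Data.Product.Base using (_×_; _,_; proj₁; proj₂; ∃; ∃₂)
open import Data.Sum.Base using (_⊎_; inj₁; inj₂)
open import Data.Vec.Base using (Vec; []; _∷_)
open import Data.Vec.Relation.Unary.All using (All; []; _∷_)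
open import Function.Bundles using (Equivalence)
open import Function.Definitions using (Injective)
open import Relation.Binary.PropositionalEquality
open import Relation.Nullary.Negation.Core using (¬_; contradiction)

-- Counting the entries of a list

lookup-injective : ∀ {A : Set} {xs : List A} → Unique xs → Injective _≡_ _≡_ (lookup xs)
lookup-injective (_ ∷ _)    {zero}  {zero}  _  = refl
lookup-injective (x∉ ∷ _)   {zero}  {suc j} eq = contradiction eq (ListAll.lookup x∉ (∈-lookup j))
lookup-injective (x∉ ∷ _)   {suc i} {zero}  eq = contradiction (sym eq) (ListAll.lookup x∉ (∈-lookup i))
lookup-injective (_ ∷ uniq) {suc i} {suc j} eq = cong suc (lookup-injective uniq eq)

-- Pigeonhole: uniqueness makes `lookup xs` injective, so positions inject into `Fin p` through `f`.
-- It bounds the number of solutions from above, with `f` reading off the coefficient of `c`.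
length≤ : ∀ {A : Set} {xs : List A} {p} → Unique xs → (f : A → ℕ) →
          (∀ {x} → x ∈ xs → f x ℕ.< p) →
          (∀ {x y} → x ∈ xs → y ∈ xs → f x ≡ f y → x ≡ y) →
          length xs ℕ.≤ p
length≤ {xs = xs} uniq f f<p f-inj =
  injective⇒≤ {f = λ i → fromℕ< (f<p (∈-lookup i))} λ {i} {j} eq →
    lookup-injective uniq
      (f-inj (∈-lookup i) (∈-lookup j)
        (fromℕ<-injective (f (lookup xs i)) (f (lookup xs j)) (f<p (∈-lookup i)) (f<p (∈-lookup j)) eq))

-- A position determines its entry, so distinct values `f i` sit at distinct positions.
≤length : ∀ {A : Set} {xs : List A} {p} (f : Fin p → A) → Injective _≡_ _≡_ f →
          (∀ i → f i ∈ xs) → p ℕ.≤ length xs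
≤length {xs = xs} f f-inj f∈ = injective⇒≤ {f = λ i → index (f∈ i)} λ {i} {j} eq →
  f-inj (trans (lookup-index (f∈ i)) (trans (cong (lookup xs) eq) (sym (lookup-index (f∈ j)))))

module LinearForms where

  open import Data.Nat.Base using (_+_; _*_; _≤_; _<_)

  -- n ≡ bt (mod a), in a form without subtraction.
  ∃-residue : ∀ {a b} → 0 < a → Coprime a b → ∀ n →
              ∃ λ t → ∃₂ λ v v′ → t < a × n + a * v ≡ b * t + a * v′
  ∃-residue {suc a} {b} _ cop n with multiple
    where
    multiple : ∃ λ s → ∃₂ λ v v′ → n + suc a * v ≡ b * s + suc a * v′
    multiple with coprime-Bézout cop
    ... | Bézout.-+ x y eq = y * n , x * n , 0 , (begin
      n + suc a * (x * n)           ≡⟨ lhs n (suc a) x ⟩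
      (1 + x * suc a) * n           ≡⟨ cong (_* n) eq ⟩
      y * b * n                       ≡⟨ rhs y b n (suc a) ⟩
      b * (y * n) + suc a * 0     ∎)
      where
      open ≡-Reasoning
      lhs : ∀ n a x → n + a * (x * n) ≡ (1 + x * a) * n
      lhs = solve-∀
      rhs : ∀ y b n a → y * b * n ≡ b * (y * n) + a * 0
      rhs = solve-∀
    -- Here `1 + y * b ≡ x * suc a`, so `b` has inverse `-y`. The modulus is `suc a`, hence `a` acts
    -- as `-1` and `y * n * a` stands for `-y * n`.
    ... | Bézout.+- x y eq = y * n * a , n * (y * b) , n * x , (begin
      n + suc a * (n * (y * b))                 ≡⟨ lhs n a y b ⟩
      (1 + y * b) * n + b * (y * n * a)   ≡⟨ cong (λ h → h * n + b * (y * n * a)) eq ⟩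
      x * suc a * n + b * (y * n * a)       ≡⟨ rhs x a n b y ⟩
      b * (y * n * a) + suc a * (n * x)     ∎)
      where
      open ≡-Reasoning
      lhs : ∀ n a y b → n + suc a * (n * (y * b)) ≡ (1 + y * b) * n + b * (y * n * a)
      lhs = solve-∀
      rhs : ∀ x a n b y → x * suc a * n + b * (y * n * a) ≡ b * (y * n * a) + suc a * (n * x)
      rhs = solve-∀
  ... | s , v , v′ , eq = s % suc a , v , b * (s / suc a) + v′ , m%n<n s (suc a) , (begin
      n + suc a * v                                                   ≡⟨ eq ⟩
      b * s + suc a * v′                                            ≡⟨ cong (λ h → b * h + suc a * v′) (m≡m%n+[m/n]*n s (suc a)) ⟩
      b * (s % suc a + s / suc a * suc a) + suc a * v′          ≡⟨ regroup b (s % suc a) (s / suc a) (suc a) v′ ⟩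
      b * (s % suc a) + suc a * (b * (s / suc a) + v′)          ∎)
    where
    open ≡-Reasoning
    regroup : ∀ b m q a v → b * (m + q * a) + a * v ≡ b * m + a * (b * q + v)
    regroup = solve-∀

  -- Forms in three coefficients tied by one linear relation

  module ThreeTerms {a b c u w : ℕ} (relation : c + u * a ≡ w * b) (1≤u : 1 ≤ u) (2u≤w : u + u ≤ w)
                    (w≤a : w ≤ a) (a≤b : a ≤ b) (coprime : Coprime a b) where

    1≤w : 1 ≤ w
    1≤w = ≤-trans 1≤u (≤-trans (m≤m+n u u) 2u≤w)

    instance
      a-nonZero : NonZero a
      a-nonZero = >-nonZero (≤-trans 1≤w w≤a)

      w-nonZero : NonZero w
      w-nonZero = >-nonZero 1≤w

    -- From `2ua ≤ wb = c + ua`. It caps at `2c` the cost `w * b` of replacing one `c` by `w` copies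
    -- of `b`.
    ua≤c : u * a ≤ c
    ua≤c = +-cancelʳ-≤ (u * a) (u * a) c (begin
      u * a + u * a  ≡⟨ *-distribʳ-+ a u u ⟨
      (u + u) * a    ≤⟨ *-mono-≤ 2u≤w a≤b ⟩
      w * b          ≡⟨ relation ⟨
      c + u * a      ∎)
      where open ≤-Reasoning

    trade : ∀ y z → b * y + c * z + u * a * z ≡ b * (y + w * z)
    trade y z = begin
      b * y + c * z + u * a * z    ≡⟨ collect b y c z (u * a) ⟩
      b * y + (c + u * a) * z      ≡⟨ cong (λ h → b * y + h * z) relation ⟩
      b * y + w * b * z            ≡⟨ factor b y w z ⟩
      b * (y + w * z)              ∎
      where
      open ≡-Reasoning
      collect : ∀ b y c z d → b * y + c * z + d * z ≡ b * y + (c + d) * z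
      collect = solve-∀
      factor : ∀ b y w z → b * y + w * b * z ≡ b * (y + w * z)
      factor = solve-∀

    -- Cancelling leaves bj < u(z - Z), whereas w(z - Z) < w + ja ≤ 2ja and 2u ≤ w.
    excess-impossible : ∀ {Y Z} x y z j → Y < w → y + w * z ≡ Y + w * Z + j * a →
                        u * Z + (x + 1 + b * j) ≡ u * z → ⊥
    excess-impossible {Y} {Z} x y z j Y<w s≡ eq = m+n≮n 1 _ 2+2bj≤2bj
      where
      open ≤-Reasoning

      Z<z : Z < z
      Z<z = *-cancelˡ-< u Z z (begin-strict
        u * Z                        <⟨ m<m+n (u * Z) (≤-trans (m≤n+m 1 x) (m≤m+n (x + 1) (b * j))) ⟩
        u * Z + (x + 1 + b * j)      ≡⟨ eq ⟩
        u * z                        ∎)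

      m : ℕ
      m = z ∸ suc Z

      z≡ : suc Z + m ≡ z
      z≡ = m+[n∸m]≡n Z<z

      1+bj≤u+um : suc (b * j) ≤ u + u * m
      1+bj≤u+um = +-cancelˡ-≤ (u * Z) _ _ (begin
        u * Z + suc (b * j)          ≤⟨ +-monoʳ-≤ (u * Z) (m≤n+m (suc (b * j)) x) ⟩
        u * Z + (x + suc (b * j))    ≡⟨ cong (u * Z +_) (sym (+-assoc x 1 (b * j))) ⟩
        u * Z + (x + 1 + b * j)      ≡⟨ eq ⟩
        u * z                        ≡⟨ cong (u *_) z≡ ⟨
        u * (suc Z + m)              ≡⟨ expand u Z m ⟩
        u * Z + (u + u * m)          ∎)
        where
        expand : ∀ u Z m → u * (1 + Z + m) ≡ u * Z + (u + u * m)
        expand = solve-∀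

      wm<ja : w * m < j * a
      wm<ja = +-cancelˡ-< (w + w * Z) _ _ (begin-strict
        w + w * Z + w * m      ≡⟨ expand w Z m ⟩
        w * (suc Z + m)        ≡⟨ cong (w *_) z≡ ⟩
        w * z                  ≤⟨ m≤n+m (w * z) y ⟩
        y + w * z              ≡⟨ s≡ ⟩
        Y + w * Z + j * a      <⟨ +-monoˡ-< (j * a) (+-monoˡ-< (w * Z) Y<w) ⟩
        w + w * Z + j * a      ∎)
        where
        expand : ∀ w Z m → w + w * Z + w * m ≡ w * (1 + Z + m)
        expand = solve-∀

      -- `wm<ja` rules out `j ≡ 0`.
      a≤ja : a ≤ j * a
      a≤ja = m≤n*m a j {{>-nonZero (*-cancelʳ-< a 0 j (≤-<-trans z≤n wm<ja))}}

      ja≤bj : j * a ≤ b * j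
      ja≤bj = ≤-trans (*-monoʳ-≤ j a≤b) (≤-reflexive (*-comm j b))

      -- Doubling `1+bj≤u+um` makes `2u≤w` applicable; the leftover `w` is absorbed by
      -- `w ≤ a ≤ j * a`.
      2+2bj≤2bj : suc (suc (b * j + b * j)) ≤ b * j + b * j
      2+2bj≤2bj = begin
        suc (suc (b * j + b * j))            ≡⟨ cong suc (+-suc (b * j) (b * j)) ⟨
        suc (b * j) + suc (b * j)            ≤⟨ +-mono-≤ 1+bj≤u+um 1+bj≤u+um ⟩
        u + u * m + (u + u * m)              ≡⟨ double u m ⟩
        (u + u) + (u + u) * m                ≤⟨ +-mono-≤ 2u≤w (*-monoˡ-≤ m 2u≤w) ⟩
        w + w * m                            ≤⟨ +-mono-≤ w≤a (<⇒≤ wm<ja) ⟩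
        a + j * a                            ≤⟨ +-monoˡ-≤ (j * a) a≤ja ⟩
        j * a + j * a                        ≤⟨ +-mono-≤ ja≤bj ja≤bj ⟩
        b * j + b * j                        ∎
        where
        double : ∀ u m → u + u * m + (u + u * m) ≡ (u + u) + (u + u) * m
        double = solve-∀

    -- Solutions at the claimed value

    multiple-below-twice : ∀ {δ} → 0 < δ → δ < a + a → a ∣ δ → δ ≡ a
    multiple-below-twice 0<δ _ (divides-refl zero)          = contradiction 0<δ λ ()
    multiple-below-twice _   _ (divides-refl (suc zero))    = *-identityˡ a
    multiple-below-twice _ δ<2a (divides-refl (suc (suc j))) =
      contradiction (<-≤-trans δ<2a (≤-trans (m≤m+n (a + a) (j * a)) (≤-reflexive (+-assoc a a (j * a))))) (<-irrefl refl)

    -- b(y + wz) ≡ b(Y + wZ) (mod a), with the multiples of a made explicit.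
    congruent : ∀ {Y Z} x y z → a * x + (b * y + c * z) + a ≡ b * Y + c * Z →
                b * (y + w * z) + a * (x + 1 + u * Z) ≡ b * (Y + w * Z) + a * (u * z)
    congruent {Y} {Z} x y z eq = begin
      b * (y + w * z) + a * (x + 1 + u * Z)                  ≡⟨ cong (_+ a * (x + 1 + u * Z)) (trade y z) ⟨
      b * y + c * z + u * a * z + a * (x + 1 + u * Z)        ≡⟨ regroup a (b * y + c * z) u x z Z ⟩
      a * x + (b * y + c * z) + a + u * a * Z + a * (u * z)  ≡⟨ cong (λ h → h + u * a * Z + a * (u * z)) eq ⟩
      b * Y + c * Z + u * a * Z + a * (u * z)                ≡⟨ cong (_+ a * (u * z)) (trade Y Z) ⟩
      b * (Y + w * Z) + a * (u * z)                          ∎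
      where
      open ≡-Reasoning
      regroup : ∀ a v u x z Z → v + u * a * z + a * (x + 1 + u * Z) ≡
                a * x + v + a + u * a * Z + a * (u * z)
      regroup = solve-∀

    -- `a` divides `b * (S ∸ s)` and is coprime to `b`. The cancelled equation is returned as well,
    -- because divisibility alone forgets the sizes of `e` and `E`.
    difference-multiple : ∀ {s S e E} → s ≤ S → b * s + a * e ≡ b * S + a * E →
                          a ∣ S ∸ s × a * e ≡ a * E + b * (S ∸ s)
    difference-multiple {s} {S} {e} {E} s≤S eq =
      coprime-divisor coprime (∣m+n∣m⇒∣n (subst (a ∣_) reduced (m∣m*n e)) (m∣m*n E)) , reduced
      where
      open ≡-Reasoning
      reduced : a * e ≡ a * E + b * (S ∸ s)
      reduced = +-cancelˡ-≡ (b * s) _ _ (begin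
        b * s + a * e                   ≡⟨ eq ⟩
        b * S + a * E                   ≡⟨ cong (λ h → b * h + a * E) (m+[n∸m]≡n s≤S) ⟨
        b * (s + (S ∸ s)) + a * E       ≡⟨ expand b s (S ∸ s) (a * E) ⟩
        b * s + (a * E + b * (S ∸ s))   ∎)
        where
        expand : ∀ b s δ e → b * (s + δ) + e ≡ b * s + (e + b * δ)
        expand = solve-∀

    -- Put `s = y + w * z` and `S = Y + w * Z`; they differ by a multiple of `a`. If `s < S`, then
    -- `S<2a` leaves only the difference `a`, and `w * z ≤ s = S - a < p * w`. If `s ≥ S`, the value
    -- is already too large, by `excess-impossible`.
    deficit-solution : ∀ {p Y Z} x y z → Y < w → Y + w * Z < a + a → Y + w * Z < p * w + a →
            a * x + (b * y + c * z) + a ≡ b * Y + c * Z →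
            z < p × y + w * z + a ≡ Y + w * Z
    deficit-solution {p} {Y} {Z} x y z Y<w S<2a S<pw+a eq
      with <-≤-connex (y + w * z) (Y + w * Z)
    ... | inj₁ s<S = z<p , s+a≡S
      where
      s+a≡S : y + w * z + a ≡ Y + w * Z
      s+a≡S = trans
        (cong (y + w * z +_)
          (sym (multiple-below-twice (m<n⇒0<n∸m s<S) (≤-<-trans (m∸n≤m _ (y + w * z)) S<2a)
            (proj₁ (difference-multiple (<⇒≤ s<S) (congruent x y z eq))))))
        (m+[n∸m]≡n (<⇒≤ s<S))

      z<p : z < p
      z<p = *-cancelˡ-< w z p (≤-<-trans (m≤n+m (w * z) y)
        (+-cancelʳ-< a (y + w * z) (w * p) (subst₂ _<_ (sym s+a≡S) (cong (_+ a) (*-comm p w)) S<pw+a)))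
    ... | inj₂ S≤s
      with divides j δ≡ja , reduced ← difference-multiple S≤s (sym (congruent x y z eq)) =
      contradiction cancelled (excess-impossible x y z j Y<w s≡)
      where
      s≡ : y + w * z ≡ Y + w * Z + j * a
      s≡ = trans (sym (m+[n∸m]≡n S≤s)) (cong (Y + w * Z +_) δ≡ja)

      cancelled : u * Z + (x + 1 + b * j) ≡ u * z
      cancelled = *-cancelˡ-≡ _ _ a (begin
        a * (u * Z + (x + 1 + b * j))                             ≡⟨ regroup a u Z x b j ⟩
        a * (x + 1 + u * Z) + b * (j * a)                         ≡⟨ cong (λ h → a * (x + 1 + u * Z) + b * h) δ≡ja ⟨
        a * (x + 1 + u * Z) + b * (y + w * z ∸ (Y + w * Z))       ≡⟨ reduced ⟨
        a * (u * z)                                               ∎)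
        where
        open ≡-Reasoning
        regroup : ∀ a u Z x b j → a * (u * Z + (x + 1 + b * j)) ≡ a * (x + 1 + u * Z) + b * (j * a)
        regroup = solve-∀

    -- Constructing solutions at larger values

    -- `n` and `v` agree modulo `a`, so `v < n + a` already forces `v ≤ n`, and copies of `a` fill
    -- the gap.
    top-up : ∀ {n v e e′} → v < n + a → n + a * e ≡ v + a * e′ → ∃ λ x → a * x + v ≡ n
    top-up {n} {v} {e} {e′} v<n+a eq with <-≤-connex e′ e
    ... | inj₁ e′<e = contradiction v<n+a (≤⇒≯ (+-cancelʳ-≤ (a * e′) (n + a) v (begin
      n + a + a * e′    ≡⟨ regroup n a e′ ⟩
      n + a * suc e′    ≤⟨ +-monoʳ-≤ n (*-monoʳ-≤ a e′<e) ⟩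
      n + a * e         ≡⟨ eq ⟩
      v + a * e′        ∎)))
      where
      open ≤-Reasoning
      regroup : ∀ n a e → n + a + a * e ≡ n + a * (1 + e)
      regroup = solve-∀
    ... | inj₂ e≤e′ = e′ ∸ e , +-cancelʳ-≡ (a * e) _ _ (begin
      a * (e′ ∸ e) + v + a * e    ≡⟨ regroup a (e′ ∸ e) v e ⟩
      v + a * (e + (e′ ∸ e))      ≡⟨ cong (λ h → v + a * h) (m+[n∸m]≡n e≤e′) ⟩
      v + a * e′                  ≡⟨ eq ⟨
      n + a * e                   ∎)
      where
      open ≡-Reasoning
      regroup : ∀ a x v e → a * x + v + a * e ≡ v + a * (e + x)
      regroup = solve-∀

    %+*/≡ : ∀ s → s % w + w * (s / w) ≡ s
    %+*/≡ s = trans (cong (s % w +_) (*-comm w (s / w))) (sym (m≡m%n+[m/n]*n s w))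

    -- The cheapest pair with `y + w * z ≡ s` has `z = s / w`. Each of the `m` swaps away from it
    -- replaces `c` by `w * b = c + u * a ≤ 2c`, raising the value by at most `c`; hence the
    -- `s / w + m` in the bound.
    represent : ∀ {n e e′} s m → m ≤ s / w → n + a * e ≡ b * s + a * e′ →
                b * (s % w) + c * (s / w + m) < n + a →
                ∃₂ λ x y → a * x + (b * y + c * (s / w ∸ m)) ≡ n × y + w * (s / w ∸ m) ≡ s
    represent {n} {e} {e′} s m m≤q eq bound = proj₁ topped , y , proj₂ topped , y+wz≡s
      where
      q z y : ℕ
      q = s / w
      z = q ∸ m
      y = s % w + w * m

      m+z≡q : m + z ≡ q
      m+z≡q = m+[n∸m]≡n m≤q

      y+wz≡s : y + w * z ≡ s
      y+wz≡s = begin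
        s % w + w * m + w * z  ≡⟨ regroup (s % w) w m z ⟩
        s % w + w * (m + z)    ≡⟨ cong (λ h → s % w + w * h) m+z≡q ⟩
        s % w + w * q          ≡⟨ %+*/≡ s ⟩
        s                      ∎
        where
        open ≡-Reasoning
        regroup : ∀ σ w m z → σ + w * m + w * z ≡ σ + w * (m + z)
        regroup = solve-∀

      value≤ : b * y + c * z ≤ b * (s % w) + c * (q + m)
      value≤ = begin
        b * (s % w + w * m) + c * z                  ≡⟨ regroup b (s % w) w m (c * z) ⟩
        b * (s % w) + w * b * m + c * z              ≡⟨ cong (λ h → b * (s % w) + h * m + c * z) relation ⟨
        b * (s % w) + (c + u * a) * m + c * z        ≤⟨ +-monoˡ-≤ (c * z) (+-monoʳ-≤ (b * (s % w)) (*-monoˡ-≤ m (+-monoʳ-≤ c ua≤c))) ⟩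
        b * (s % w) + (c + c) * m + c * z            ≡⟨ collect (b * (s % w)) c m z ⟩
        b * (s % w) + c * (m + z + m)                ≡⟨ cong (λ h → b * (s % w) + c * (h + m)) m+z≡q ⟩
        b * (s % w) + c * (q + m)                    ∎
        where
        open ≤-Reasoning
        regroup : ∀ b σ w m d → b * (σ + w * m) + d ≡ b * σ + w * b * m + d
        regroup = solve-∀
        collect : ∀ v c m z → v + (c + c) * m + c * z ≡ v + c * (m + z + m)
        collect = solve-∀

      congruence : n + a * e ≡ b * y + c * z + a * (u * z + e′)
      congruence = begin
        n + a * e                              ≡⟨ eq ⟩
        b * s + a * e′                         ≡⟨ cong (λ h → b * h + a * e′) y+wz≡s ⟨
        b * (y + w * z) + a * e′               ≡⟨ cong (_+ a * e′) (trade y z) ⟨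
        b * y + c * z + u * a * z + a * e′     ≡⟨ regroup (b * y + c * z) u a z e′ ⟩
        b * y + c * z + a * (u * z + e′)       ∎
        where
        open ≡-Reasoning
        regroup : ∀ v u a z e → v + u * a * z + a * e ≡ v + a * (u * z + e)
        regroup = solve-∀

      topped : ∃ λ x → a * x + (b * y + c * z) ≡ n
      topped = top-up (≤-<-trans value≤ bound) congruence

    form : Vec ℕ 3
    form = a ∷ b ∷ c ∷ []

    form-nonZero : All NonZero form
    form-nonZero = a-nonZero ∷ >-nonZero (<-≤-trans 0<a a≤b) ∷ >-nonZero (<-≤-trans 0<a (≤-trans (m≤n*m a u {{>-nonZero 1≤u}}) ua≤c)) ∷ []
      where
      0<a : 0 < a
      0<a = ≤-trans 1≤w w≤a

    form· : ∀ x y z → form · (x ∷ y ∷ z ∷ []) ≡ a * x + (b * y + c * z)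
    form· x y z = cong (λ h → a * x + (b * y + h)) (+-identityʳ (c * z))

    -- The m-th solution has y + wz = t and z = q - m as long as m ≤ q = ⌊t/w⌋; the next
    -- ones have y + wz = t + a and z = Q - (m - q - 1) with Q = ⌊(t + a)/w⌋.
    many-solutions : ∀ {p r n} → r * w < a → p ≤ r →
                     (∀ σ e → σ < w → σ + w * e < a + p * w → b * σ + c * e < n + a) →
                     p < length (solutions n form)
    many-solutions {p} {r} {n} rw<a p≤r bound with ∃-residue (≤-trans 1≤w w≤a) coprime n
    ... | t , e , e′ , t<a , residue = ≤length (λ i → proj₁ (nth i)) injective (λ i → proj₁ (proj₂ (nth i)))
      where
      q Q : ℕ
      q = t / w
      Q = (t + a) / w

      Nth : ℕ → Vec ℕ 3 → Set
      Nth m (x ∷ y ∷ z ∷ []) = (y + w * z ≡ t × z + m ≡ q) ⊎ (y + w * z ≡ t + a × z + m ≡ Q + suc q)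

      -- The sum `y + w * z` reveals the alternative, since `t` and `t + a` differ, and then `z`
      -- reveals `m`. This keeps the constructed solutions distinct.
      Nth-unique : ∀ {m m′} v → Nth m v → Nth m′ v → m ≡ m′
      Nth-unique (x ∷ y ∷ z ∷ []) (inj₁ (_ , eq))  (inj₁ (_ , eq′)) = +-cancelˡ-≡ z _ _ (trans eq (sym eq′))
      Nth-unique (x ∷ y ∷ z ∷ []) (inj₂ (_ , eq))  (inj₂ (_ , eq′)) = +-cancelˡ-≡ z _ _ (trans eq (sym eq′))
      Nth-unique (x ∷ y ∷ z ∷ []) (inj₁ (s≡t , _)) (inj₂ (s≡t+a , _)) =
        contradiction (trans (sym s≡t) s≡t+a) (<⇒≢ (m<m+n t (≤-trans 1≤w w≤a)))
      Nth-unique (x ∷ y ∷ z ∷ []) (inj₂ (s≡t+a , _)) (inj₁ (s≡t , _)) =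
        contradiction (trans (sym s≡t) s≡t+a) (<⇒≢ (m<m+n t (≤-trans 1≤w w≤a)))

      bound′ : ∀ s m → s + w * m < a + p * w → b * (s % w) + c * (s / w + m) < n + a
      bound′ s m lt = bound (s % w) (s / w + m) (m%n<n s w) (subst (_< a + p * w) (begin
        s + w * m                          ≡⟨ cong (_+ w * m) (%+*/≡ s) ⟨
        s % w + w * (s / w) + w * m        ≡⟨ regroup (s % w) w (s / w) m ⟩
        s % w + w * (s / w + m)            ∎) lt)
        where
        open ≡-Reasoning
        regroup : ∀ σ w q m → σ + w * q + w * m ≡ σ + w * (q + m)
        regroup = solve-∀

      -- Room for the second run: its shifts are at most `p ≤ r`, and `r * w < a ≤ t + a` gives
      -- `Q ≥ r`.
      r≤Q : r ≤ Q
      r≤Q = subst (_≤ Q) (m*n/n≡m r w) (/-monoˡ-≤ w (≤-trans (<⇒≤ rw<a) (m≤n+m a t)))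

      ∈form : ∀ {x y z} → a * x + (b * y + c * z) ≡ n → x ∷ y ∷ z ∷ [] ∈ solutions n form
      ∈form {x} {y} {z} eq = Equivalence.from (∈-solutions n form-nonZero _) (trans (form· x y z) eq)

      construct : ∀ m → m ≤ p → ∃ λ v → v ∈ solutions n form × Nth m v
      construct m m≤p with <-≤-connex q m
      ... | inj₂ m≤q =
        let x , y , eq , s≡ = represent t m m≤q residue
              (bound′ t m (+-mono-<-≤ t<a (≤-trans (*-monoʳ-≤ w m≤p) (≤-reflexive (*-comm w p)))))
        in x ∷ y ∷ (q ∸ m) ∷ [] , ∈form eq , inj₁ (s≡ , m∸n+n≡m m≤q)
      ... | inj₁ q<m =
        let x , y , eq , s≡ = represent (t + a) m′ m′≤Q residue′ (bound′ (t + a) m′ small)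
        in x ∷ y ∷ (Q ∸ m′) ∷ [] , ∈form eq , inj₂ (s≡ , (begin-equality
          Q ∸ m′ + m               ≡⟨ cong (Q ∸ m′ +_) m′+1+q≡m ⟨
          Q ∸ m′ + (m′ + suc q)    ≡⟨ +-assoc (Q ∸ m′) m′ (suc q) ⟨
          Q ∸ m′ + m′ + suc q      ≡⟨ cong (_+ suc q) (m∸n+n≡m m′≤Q) ⟩
          Q + suc q                ∎))
        where
        open ≤-Reasoning

        -- The first run uses the indices `0` to `q`, so the second starts with shift 0 at `suc q`.
        m′ : ℕ
        m′ = m ∸ suc q

        m′+1+q≡m : m′ + suc q ≡ m
        m′+1+q≡m = m∸n+n≡m q<m

        m′≤Q : m′ ≤ Q
        m′≤Q = ≤-trans (m∸n≤m m (suc q)) (≤-trans m≤p (≤-trans p≤r r≤Q))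

        residue′ : n + a * (e + b) ≡ b * (t + a) + a * e′
        residue′ = trans (lhs n a e b) (trans (cong (_+ a * b) residue) (rhs b t a e′))
          where
          lhs : ∀ n a e b → n + a * (e + b) ≡ n + a * e + a * b
          lhs = solve-∀
          rhs : ∀ b t a e → b * t + a * e + a * b ≡ b * (t + a) + a * e
          rhs = solve-∀

        t<w+wq : t < w + w * q
        t<w+wq = subst (_< w + w * q) (%+*/≡ t) (+-monoˡ-< (w * q) (m%n<n t w))

        -- `t < w * suc q` pays for the `suc q` indices of the first run, leaving `w * m ≤ p * w`.
        small : t + a + w * m′ < a + p * w
        small = begin-strict
          t + a + w * m′                  ≡⟨ regroup t a (w * m′) ⟩
          a + (t + w * m′)                <⟨ +-monoʳ-< a (+-monoˡ-< (w * m′) t<w+wq) ⟩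
          a + (w + w * q + w * m′)        ≡⟨ cong (λ h → a + h) (factor w q m′) ⟩
          a + (m′ + suc q) * w            ≡⟨ cong (λ h → a + h * w) m′+1+q≡m ⟩
          a + m * w                       ≤⟨ +-monoʳ-≤ a (*-monoˡ-≤ w m≤p) ⟩
          a + p * w                       ∎
          where
          regroup : ∀ t a d → t + a + d ≡ a + (t + d)
          regroup = solve-∀
          factor : ∀ w q m → w + w * q + w * m ≡ (m + (1 + q)) * w
          factor = solve-∀

      nth : (i : Fin (suc p)) → ∃ λ v → v ∈ solutions n form × Nth (toℕ i) v
      nth i = construct (toℕ i) (ℕ.s≤s⁻¹ (toℕ<n i))

      injective : Injective _≡_ _≡_ (λ i → proj₁ (nth i))
      injective {i} {j} eq = toℕ-injective
        (Nth-unique (proj₁ (nth i)) (proj₂ (proj₂ (nth i))) (subst (Nth (toℕ j)) (sym eq) (proj₂ (proj₂ (nth j)))))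

    -- Bounding the count from both sides

    -- All solutions share the same `y + w * z`, so `z` fixes `y` and then `x`, while `z < p` leaves
    -- at most `p` choices.
    few-solutions : ∀ {p Y Z G} → Y < w → Y + w * Z < a + a → Y + w * Z < p * w + a →
                    G + a ≡ b * Y + c * Z → length (solutions G form) ≤ p
    few-solutions {p} {Y} {Z} {G} Y<w S<2a S<pw+a G+a≡ =
      length≤ (solutions-unique G form) third
        (λ {v} v∈ → third<p v (sols v v∈))
        λ {v} {v′} v∈ v′∈ → determined v v′ (sols v v∈) (sols v′ v′∈)
      where
      third : Vec ℕ 3 → ℕ
      third (_ ∷ _ ∷ z ∷ []) = z

      Solves : Vec ℕ 3 → Set
      Solves (x ∷ y ∷ z ∷ []) = a * x + (b * y + c * z) ≡ G

      sols : ∀ v → v ∈ solutions G form → Solves v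
      sols v@(x ∷ y ∷ z ∷ []) v∈ = trans (sym (form· x y z)) (Equivalence.to (∈-solutions G form-nonZero v) v∈)

      constraints : ∀ x y z → Solves (x ∷ y ∷ z ∷ []) → z < p × y + w * z + a ≡ Y + w * Z
      constraints x y z eq = deficit-solution x y z Y<w S<2a S<pw+a (trans (cong (_+ a) eq) G+a≡)

      third<p : ∀ v → Solves v → third v < p
      third<p (x ∷ y ∷ z ∷ []) eq = proj₁ (constraints x y z eq)

      determined : ∀ v v′ → Solves v → Solves v′ → third v ≡ third v′ → v ≡ v′
      determined (x ∷ y ∷ z ∷ []) (x′ ∷ y′ ∷ z ∷ []) eq eq′ refl
        with refl ← +-cancelʳ-≡ (w * z) y y′ (+-cancelʳ-≡ a _ _
               (trans (proj₂ (constraints x y z eq)) (sym (proj₂ (constraints x′ y′ z eq′)))))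
        with refl ← *-cancelˡ-≡ x x′ a (+-cancelʳ-≡ (b * y + c * z) _ _ (trans eq (sym eq′))) = refl

    -- `G + a` is the maximum of `b * σ + c * e` over the region in which `many-solutions` asks for
    -- a bound, so every `n > G` meets its condition.
    frobenius : ∀ {p r Y Z G} → r * w < a → p ≤ r →
                Y < w → Y + w * Z < a + a → Y + w * Z < p * w + a →
                (∀ σ e → σ < w → σ + w * e < a + p * w → b * σ + c * e ≤ b * Y + c * Z) →
                G + a ≡ b * Y + c * Z → IsFrobenius p form (ℤ.+ G)
    frobenius {p} {r} {Y} {Z} {G} rw<a p≤r Y<w S<2a S<pw+a bound G+a≡ =
      few-solutions Y<w S<2a S<pw+a G+a≡ , largest
      where
      largest : ∀ n → d n form ≤ p → n ℤ.≤ ℤ.+ G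
      -- `d` is 0 at negative integers, so they qualify as candidates; they lie below because `G` is
      -- a natural number.
      largest ℤ.-[1+ n ] _  = ℤ.-≤+
      largest (ℤ.+ n)    d≤p = ℤ.+≤+ (≮⇒≥ λ G<n → ≤⇒≯ d≤p
        (many-solutions rw<a p≤r λ σ e σ<w lt → ≤-<-trans (bound σ e σ<w lt) (subst (_< n + a) G+a≡ (+-monoˡ-< a G<n))))

    -- The two candidates for the maximum and their comparison

    module Threshold {p r Y W R : ℕ} (a≡ : a ≡ suc (Y + r * w)) (Y<w : Y < w) (W≡ : suc W ≡ w)
                     (p≤r : p ≤ r) (R≡ : suc R ≡ r + p) where

      rw<a : r * w < a
      rw<a = subst (r * w <_) (sym a≡) (s≤s (m≤n+m (r * w) Y))

      pw<a : p * w < a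
      pw<a = ≤-<-trans (*-monoˡ-≤ w p≤r) rw<a

      -- Lexicographic in (e, σ): either e ≥ r + p, which forces e = r + p and σ ≤ Y, or e ≤ R.
      bounded : ∀ σ e → σ < w → σ + w * e < a + p * w →
                b * σ + c * e ≤ b * Y + c * suc R ⊎ b * σ + c * e ≤ b * W + c * R
      bounded σ e σ<w lt with <-≤-connex R e
      ... | inj₂ e≤R = inj₂ (+-mono-≤ (*-monoʳ-≤ b (ℕ.s≤s⁻¹ (subst (σ <_) (sym W≡) σ<w))) (*-monoʳ-≤ c e≤R))
      ... | inj₁ R<e = inj₁ (+-mono-≤ (*-monoʳ-≤ b σ≤Y) (*-monoʳ-≤ c e≤1+R))
        where
        open ≤-Reasoning

        -- `a + p * w` is one more than `Y + w * (r + p)`, which turns the strict bound into a weak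
        -- one.
        value≤ : σ + w * e ≤ Y + w * suc R
        value≤ = ℕ.s≤s⁻¹ (begin-strict
          σ + w * e                    <⟨ lt ⟩
          a + p * w                    ≡⟨ cong (_+ p * w) a≡ ⟩
          suc (Y + r * w) + p * w      ≡⟨ collect Y r w p ⟩
          suc (Y + w * (r + p))        ≡⟨ cong (λ h → suc (Y + w * h)) R≡ ⟨
          suc (Y + w * suc R)          ∎)
          where
          collect : ∀ Y r w p → 1 + (Y + r * w) + p * w ≡ 1 + (Y + w * (r + p))
          collect = solve-∀

        σ≤Y : σ ≤ Y
        σ≤Y = +-cancelʳ-≤ (w * suc R) σ Y (≤-trans (+-monoʳ-≤ σ (*-monoʳ-≤ w R<e)) value≤)

        e≤1+R : e ≤ suc R
        e≤1+R = ℕ.s≤s⁻¹ (*-cancelˡ-< w e (suc (suc R)) (begin-strict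
          w * e              ≤⟨ m≤n+m (w * e) σ ⟩
          σ + w * e          ≤⟨ value≤ ⟩
          Y + w * suc R      <⟨ +-monoˡ-< (w * suc R) Y<w ⟩
          w + w * suc R      ≡⟨ *-suc w (suc R) ⟨
          w * suc (suc R)    ∎))

      -- The values at `(Y, r + p)` and `(W, r + p - 1)` differ by `(Y + 1) * b - u * a`. The sign
      -- of this difference is the case distinction of the theorem.
      value-comparison : b * Y + c * suc R + u * a ≡ suc Y * b + (b * W + c * R)
      value-comparison = begin
        b * Y + c * suc R + u * a            ≡⟨ collect b Y c R (u * a) ⟩
        b * Y + c * R + (c + u * a)          ≡⟨ cong (λ h → b * Y + c * R + h) relation ⟩
        b * Y + c * R + w * b                ≡⟨ cong (λ h → b * Y + c * R + h * b) W≡ ⟨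
        b * Y + c * R + suc W * b            ≡⟨ regroup b Y (c * R) W ⟩
        suc Y * b + (b * W + c * R)          ∎
        where
        open ≡-Reasoning
        collect : ∀ b Y c R d → b * Y + c * (1 + R) + d ≡ b * Y + c * R + (c + d)
        collect = solve-∀
        regroup : ∀ b Y d W → b * Y + d + (1 + W) * b ≡ (1 + Y) * b + (b * W + d)
        regroup = solve-∀

      frobenius-large : ∀ {G} → u * a ≤ suc Y * b → G + a ≡ b * Y + c * suc R → IsFrobenius p form (ℤ.+ G)
      frobenius-large ua≤ = frobenius rw<a p≤r Y<w S<2a S<pw+a bound
        where
        -- Equality after the successor: this candidate lies exactly at the edge of the region.
        S<pw+a : Y + w * suc R < p * w + a
        S<pw+a = ≤-reflexive (begin
          suc (Y + w * suc R)          ≡⟨ cong (λ h → suc (Y + w * h)) R≡ ⟩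
          suc (Y + w * (r + p))        ≡⟨ expand Y w r p ⟩
          p * w + suc (Y + r * w)      ≡⟨ cong (p * w +_) a≡ ⟨
          p * w + a                    ∎)
          where
          open ≡-Reasoning
          expand : ∀ Y w r p → 1 + (Y + w * (r + p)) ≡ p * w + (1 + (Y + r * w))
          expand = solve-∀

        S<2a : Y + w * suc R < a + a
        S<2a = <-trans S<pw+a (+-monoˡ-< a pw<a)

        W-value≤ : b * W + c * R ≤ b * Y + c * suc R
        W-value≤ = +-cancelˡ-≤ (suc Y * b) _ _ (begin
          suc Y * b + (b * W + c * R)      ≡⟨ value-comparison ⟨
          b * Y + c * suc R + u * a        ≤⟨ +-monoʳ-≤ (b * Y + c * suc R) ua≤ ⟩
          b * Y + c * suc R + suc Y * b    ≡⟨ +-comm _ (suc Y * b) ⟩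
          suc Y * b + (b * Y + c * suc R)  ∎)
          where open ≤-Reasoning

        bound : ∀ σ e → σ < w → σ + w * e < a + p * w → b * σ + c * e ≤ b * Y + c * suc R
        bound σ e σ<w lt with bounded σ e σ<w lt
        ... | inj₁ ≤Y-value = ≤Y-value
        ... | inj₂ ≤W-value = ≤-trans ≤W-value W-value≤

      frobenius-small : ∀ {G} → suc Y * b < u * a → G + a ≡ b * W + c * R → IsFrobenius p form (ℤ.+ G)
      frobenius-small <ua = frobenius rw<a p≤r (≤-reflexive W≡) S<2a S<pw+a bound
        where
        S<rw+pw : W + w * R < r * w + p * w
        S<rw+pw = ≤-reflexive (begin
          suc W + w * R    ≡⟨ cong (_+ w * R) W≡ ⟩
          w + w * R        ≡⟨ *-suc w R ⟨
          w * suc R        ≡⟨ cong (w *_) R≡ ⟩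
          w * (r + p)      ≡⟨ *-comm w (r + p) ⟩
          (r + p) * w      ≡⟨ *-distribʳ-+ w r p ⟩
          r * w + p * w    ∎)
          where open ≡-Reasoning

        S<2a : W + w * R < a + a
        S<2a = <-trans S<rw+pw (+-mono-< rw<a pw<a)

        S<pw+a : W + w * R < p * w + a
        S<pw+a = <-trans S<rw+pw (subst (_< p * w + a) (+-comm (p * w) (r * w)) (+-monoʳ-< (p * w) rw<a))

        Y-value≤ : b * Y + c * suc R ≤ b * W + c * R
        Y-value≤ = +-cancelʳ-≤ (u * a) _ _ (begin
          b * Y + c * suc R + u * a        ≡⟨ value-comparison ⟩
          suc Y * b + (b * W + c * R)      ≤⟨ +-monoˡ-≤ (b * W + c * R) (<⇒≤ <ua) ⟩
          u * a + (b * W + c * R)          ≡⟨ +-comm (u * a) _ ⟩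
          b * W + c * R + u * a            ∎)
          where open ≤-Reasoning

        bound : ∀ σ e → σ < w → σ + w * e < a + p * w → b * σ + c * e ≤ b * W + c * R
        bound σ e σ<w lt with bounded σ e σ<w lt
        ... | inj₁ ≤Y-value = ≤-trans ≤Y-value Y-value≤
        ... | inj₂ ≤W-value = ≤W-value

      -- Together with `a≤small`, this makes the truncated subtraction of `a` from the maximum
      -- exact, so in both cases the Frobenius number is a natural number.
      a≤large : a ≤ b * Y + c * suc R
      a≤large = begin
        a                    ≤⟨ m≤n*m a u {{>-nonZero 1≤u}} ⟩
        u * a                ≤⟨ ua≤c ⟩
        c                    ≤⟨ m≤m*n c (suc R) ⟩
        c * suc R            ≤⟨ m≤n+m (c * suc R) (b * Y) ⟩
        b * Y + c * suc R    ∎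
        where open ≤-Reasoning

      a≤small : a ≤ b * W + c * R
      a≤small = begin
        a                    ≤⟨ a≤b ⟩
        b                    ≤⟨ m≤m*n b W {{>-nonZero 1≤W}} ⟩
        b * W                ≤⟨ m≤m+n (b * W) (c * R) ⟩
        b * W + c * R        ∎
        where
        open ≤-Reasoning
        1≤W : 1 ≤ W
        1≤W = ℕ.s≤s⁻¹ (subst (2 ≤_) (sym W≡) (≤-trans (+-mono-≤ 1≤u 1≤u) 2u≤w))

-- Fibonacci and Lucas identities

module FibonacciLucas where

  open import Data.Nat.Base using (_+_; _*_; _≤_; _<_)

  F-mono : ∀ n → F n ≤ F (suc n)
  F-mono zero    = z≤n
  F-mono (suc n) = m≤m+n (F (suc n)) (F n)

  F+F≤F : ∀ n → F n + F n ≤ F (2 ℕ.+ n)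
  F+F≤F n = +-monoˡ-≤ (F n) (F-mono n)

  L-consecutive-coprime : ∀ n → Coprime (L n) (L (suc n))
  L-consecutive-coprime zero    = Coprimality.sym (Coprimality.1-coprimeTo 2)
  L-consecutive-coprime (suc n) = Coprimality.sym (coprime-+ (L-consecutive-coprime n))

  -- A common divisor of `L n` and `L (suc n) + L n` also divides `L (suc n)`.
  L-coprime : ∀ n → Coprime (L n) (L (2 ℕ.+ n))
  L-coprime n = Coprimality.sym (subst (λ h → Coprime h (L n)) (+-comm (L n) (L (suc n)))
    (coprime-+ (Coprimality.sym (L-consecutive-coprime n))))

  -- Both sides satisfy the Fibonacci recurrence in `j`, so the cases 0 and 1 suffice. Taken at
  -- `k ∸ 2`, it supplies `relation`.
  L-relation : ∀ i j → L (2 ℕ.+ j ℕ.+ i) + F j * L i ≡ F (2 ℕ.+ j) * L (2 ℕ.+ i)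
  L-relation i zero          = solve₀ (L (2 ℕ.+ i)) (L i)
    where
    solve₀ : ∀ x y → x + 0 * y ≡ 1 * x
    solve₀ = solve-∀
  L-relation i (suc zero)    = solve₁ (L (suc i)) (L i)
    where
    solve₁ : ∀ x y → x + y + x + 1 * y ≡ 2 * (x + y)
    solve₁ = solve-∀
  L-relation i (suc (suc j)) = begin
    L (3 ℕ.+ j ℕ.+ i) + L (2 ℕ.+ j ℕ.+ i) + (F (suc j) + F j) * L i              ≡⟨ regroup (L (3 ℕ.+ j ℕ.+ i)) (L (2 ℕ.+ j ℕ.+ i)) (F (suc j)) (F j) (L i) ⟩
    L (3 ℕ.+ j ℕ.+ i) + F (suc j) * L i + (L (2 ℕ.+ j ℕ.+ i) + F j * L i)        ≡⟨ cong₂ _+_ (L-relation i (suc j)) (L-relation i j) ⟩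
    F (3 ℕ.+ j) * L (2 ℕ.+ i) + F (2 ℕ.+ j) * L (2 ℕ.+ i)                        ≡⟨ *-distribʳ-+ (L (2 ℕ.+ i)) (F (3 ℕ.+ j)) (F (2 ℕ.+ j)) ⟨
    (F (3 ℕ.+ j) + F (2 ℕ.+ j)) * L (2 ℕ.+ i)                                    ∎
    where
    open ≡-Reasoning
    regroup : ∀ x y f g z → x + y + (f + g) * z ≡ x + f * z + (y + g * z)
    regroup = solve-∀

-- Passage to integers and the theorem

open import Data.Integer.Base using (+_; _+_; _-_; _*_; _≥_; _<_)
open import Data.Integer.Properties using (pos-+; pos-*; drop‿+≤+; drop‿+<+)
import Data.Integer.Tactic.RingSolver as ℤ-Solver

+1+m-1 : ∀ {m n} → suc m ≡ n → + n - + 1 ≡ + m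
+1+m-1 refl = refl

-- `y` and `z` are kept apart from `+ Y` and `+ Z` so that they can be the theorem's integer
-- coefficients, which involve subtractions.
value-ℤ : ∀ {a b c G Y Z y z} → y ≡ + Y → z ≡ + Z → G ℕ.+ a ≡ b ℕ.* Y ℕ.+ c ℕ.* Z →
          + G ≡ y * + b + z * + c - + a
value-ℤ {a} {b} {c} {G} {Y} {Z} refl refl eq = begin
  + G                                ≡⟨ cancel (+ G) (+ a) ⟩
  + G + + a - + a                    ≡⟨ cong (_- + a) (pos-+ G a) ⟨
  + (G ℕ.+ a) - + a                  ≡⟨ cong (λ h → + h - + a) eq ⟩
  + (b ℕ.* Y ℕ.+ c ℕ.* Z) - + a      ≡⟨ cong (_- + a) (pos-+ (b ℕ.* Y) (c ℕ.* Z)) ⟩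
  + (b ℕ.* Y) + + (c ℕ.* Z) - + a    ≡⟨ cong₂ (λ h h′ → h + h′ - + a) (flip-* b Y) (flip-* c Z) ⟩
  + Y * + b + + Z * + c - + a        ∎
  where
  open ≡-Reasoning
  cancel : ∀ x y → x ≡ x + y - y
  cancel = ℤ-Solver.solve-∀
  flip-* : ∀ m n → + (m ℕ.* n) ≡ + n * + m
  flip-* m n = trans (cong +_ (*-comm m n)) (pos-* n m)

theorem9 : ∀ (i k p : ℕ) (3≤i : 3 ℕ.≤ i) (3≤k : 3 ℕ.≤ k) →
    let r = _/_ (L i ∸ 1) (F k) {{F-nonZero 3≤k}}
        a = L i ∷ L (i ℕ.+ 2) ∷ L (i ℕ.+ k) ∷ []
    in
    r ℕ.≥ p →
    ¬ (r ≡ 0 × p ≡ 0) →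
    ((+ L i - + r * + F k) * + L (i ℕ.+ 2) ≥ + F (k ∸ 2) * + L i →
      IsFrobenius p a
        ((+ L i - + r * + F k - + 1) * + L (i ℕ.+ 2) + (+ r + + p) * + L (i ℕ.+ k) - + L i))
    ×
    ((+ L i - + r * + F k) * + L (i ℕ.+ 2) < + F (k ∸ 2) * + L i →
      IsFrobenius p a
        ((+ F k - + 1) * + L (i ℕ.+ 2) + (+ r + + p - + 1) * + L (i ℕ.+ k) - + L i))
theorem9 i 1 p _ (s≤s ())
theorem9 i 2 p _ (s≤s (s≤s ()))
theorem9 i k@(suc (suc (suc j))) p 3≤i 3≤k p≤r r,p≢0,0
  -- With `i` as the second summand the recurrence for `L` unfolds, and the terms have the shape
  -- used in `L-relation`.
  rewrite +-comm i 2 | +-comm i k = large , small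
  where
  open FibonacciLucas

  instance
    w-nonZero : NonZero (F k)
    w-nonZero = F-nonZero 3≤k

  r Y R : ℕ
  r = (L i ∸ 1) / F k
  Y = (L i ∸ 1) % F k
  R = ℕ.pred (r ℕ.+ p)

  -- `r ≡ 0` would force `p ≡ 0` through `p ≤ r`, which is the excluded pair.
  1≤r : 1 ℕ.≤ r
  1≤r = n≢0⇒n>0 λ r≡0 → r,p≢0,0 (r≡0 , n≤0⇒n≡0 (subst (p ℕ.≤_) r≡0 p≤r))

  Li≡ : L i ≡ suc (Y ℕ.+ r ℕ.* F k)
  Li≡ = trans (sym (m+[n∸m]≡n (L-pos i))) (cong suc (m≡m%n+[m/n]*n (L i ∸ 1) (F k)))

  -- Since `r ≥ 1`, at least one `F k` fits into `L i`.
  w≤a : F k ℕ.≤ L i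
  w≤a = subst (F k ℕ.≤_) (sym Li≡)
    (m≤n⇒m≤1+n (≤-trans (m≤n*m (F k) r {{>-nonZero 1≤r}}) (m≤n+m (r ℕ.* F k) Y)))

  open LinearForms.ThreeTerms {c = L (k ℕ.+ i)} {w = F k} (L-relation i (suc j)) (F-pos j) (F+F≤F (suc j)) w≤a
         (m≤n+m (L i) (L (suc i))) (L-coprime i)

  1+R≡ : suc R ≡ r ℕ.+ p
  1+R≡ = suc-pred (r ℕ.+ p) {{>-nonZero (≤-trans 1≤r (m≤m+n r p))}}

  1+W≡ : suc (ℕ.pred (F k)) ≡ F k
  1+W≡ = suc-pred (F k)

  open Threshold Li≡ (m%n<n (L i ∸ 1) (F k)) 1+W≡ p≤r 1+R≡

  -- The remainder `Y` was taken of `L i ∸ 1`, hence the successor. Both sides of the theorem's case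
  -- condition thereby become natural numbers.
  Li-rFk≡ : + L i - + r * + F k ≡ + suc Y
  Li-rFk≡ = begin
    + L i - + r * + F k                              ≡⟨ cong₂ (λ h h′ → + h - h′) Li≡ (sym (pos-* r (F k))) ⟩
    + (suc Y ℕ.+ r ℕ.* F k) - + (r ℕ.* F k)          ≡⟨ cong (_- + (r ℕ.* F k)) (pos-+ (suc Y) (r ℕ.* F k)) ⟩
    + suc Y + + (r ℕ.* F k) - + (r ℕ.* F k)          ≡⟨ cancel (+ suc Y) (+ (r ℕ.* F k)) ⟩
    + suc Y                                          ∎
    where
    open ≡-Reasoning
    cancel : ∀ x y → x + y - y ≡ x
    cancel = ℤ-Solver.solve-∀

  lhs≡ : (+ L i - + r * + F k) * + L (2 ℕ.+ i) ≡ + (suc Y ℕ.* L (2 ℕ.+ i))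
  lhs≡ = trans (cong (_* + L (2 ℕ.+ i)) Li-rFk≡) (sym (pos-* (suc Y) (L (2 ℕ.+ i))))

  rhs≡ : + F (suc j) * + L i ≡ + (F (suc j) ℕ.* L i)
  rhs≡ = sym (pos-* (F (suc j)) (L i))

  large : (+ L i - + r * + F k) * + L (2 ℕ.+ i) ≥ + F (suc j) * + L i →
          IsFrobenius p (L i ∷ L (2 ℕ.+ i) ∷ L (k ℕ.+ i) ∷ [])
            ((+ L i - + r * + F k - + 1) * + L (2 ℕ.+ i) + (+ r + + p) * + L (k ℕ.+ i) - + L i)
  large ge = subst (IsFrobenius p form)
    (value-ℤ (cong (_- + 1) Li-rFk≡) (trans (sym (pos-+ r p)) (cong +_ (sym 1+R≡))) (m∸n+n≡m a≤large))
    (frobenius-large (drop‿+≤+ (subst₂ ℤ._≤_ rhs≡ lhs≡ ge)) (m∸n+n≡m a≤large))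

  small : (+ L i - + r * + F k) * + L (2 ℕ.+ i) < + F (suc j) * + L i →
          IsFrobenius p (L i ∷ L (2 ℕ.+ i) ∷ L (k ℕ.+ i) ∷ [])
            ((+ F k - + 1) * + L (2 ℕ.+ i) + (+ r + + p - + 1) * + L (k ℕ.+ i) - + L i)
  small lt = subst (IsFrobenius p form)
    (value-ℤ (+1+m-1 1+W≡) (trans (cong (_- + 1) (sym (pos-+ r p))) (+1+m-1 1+R≡)) (m∸n+n≡m a≤small))
    (frobenius-small (drop‿+<+ (subst₂ ℤ._<_ lhs≡ rhs≡ lt)) (m∸n+n≡m a≤small))
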